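{- Let $\mathbf P=(P,\leq,*,1)$ be a strongly sectionally pseudocomplemented poset and $\Theta\in\operatorname{Con}\mathbf P$. Then $[1]\Theta\in\operatorname{Fil}\mathbf P$, and for any $x,y\in P$, $$(x,y)\in\Theta\text{ if and only if }x*y,\,y*x\in[1]\Theta,$$ i.e. $\Phi([1]\Theta)=\Theta$.
   Context: For a poset $(P,\leq)$ and $A\subseteq P$, $U(A)$ and $L(A)$ denote the sets of all upper, respectively lower, bounds of $A$; $U(a,b)=U(\{a,b\})$, $L(b)=L(\{b\})$, $L(U(a,b),c)=L(U(a,b)\cup\{c\})$. The poset is sectionally pseudocomplemented if for all $a,b\in P$ there exists a greatest element $c$ of $P$ with $L(U(a,b),c)=L(b)$; this $c$ is denoted by $a*b$, and one writes $(P,\leq,*)$. A strongly sectionally pseudocomplemented poset is a quadruple $(P,\leq,*,1)$ such that $(P,\leq,*)$ is a sectionally pseudocomplemented poset with greatest element $1$ satisfying $x\leq(x*y)*y$ for all $x,y\in P$. A binary relation $\rho$ on $P$ is $\min$-stable if whenever $(a,b),(c,d)\in\rho$, $a$ is comparable with $c$ and $b$ is comparable with $d$, then $(\min(a,c),\min(b,d))\in\rho$. A congruence on $\mathbf P$ is a $\min$-stable congruence on the algebra $(P,*,1)$; $\operatorname{Con}\mathbf P$ is the set of all of them, and $[1]\Theta$ is the $\Theta$-class of $1$. A filter of $\mathbf P$ is a subset $F$ of $P$ containing $1$ such that for all $x,y,z,v\in P$: (1) if $x*y,y*x\in F$ then $(x*z)*(y*z),(z*x)*(z*y)\in F$; (2)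 if $x*y,y*x,z*v,v*z\in F$, $x$ and $z$ are comparable and $y$ and $v$ are comparable, then $\min(x,z)*\min(y,v)\in F$. $\operatorname{Fil}\mathbf P$ is the set of all filters of $\mathbf P$. For $M\subseteq P$ put $\Phi(M):=\{(x,y)\in P^2\mid x*y,\,y*x\in M\}$. -}

module Defs where

open import Algebra.Core using (Op₂)
open import Algebra.Definitions using (Congruent₂)
open import Data.Product.Base using (_×_)
open import Data.Sum.Base using (_⊎_; inj₁; inj₂)
open import Level using (Level; _⊔_; suc)
open import Relation.Binary.Bundles using (Poset)
open import Relation.Binary.Core using (Rel; _⇒_)
open import Relation.Binary.Definitions using (Maximum; _Respects_)
open import Relation.Binary.Structures using (IsEquivalence)
open import Relation.Unary using (Pred; _∈_; _∪_; _≐_)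

infix 5 [_]_

[_]_ : ∀ {a ℓ} {A : Set a} → A → Rel A ℓ → Pred A ℓ
([ a ] Θ) x = Θ x a

-- Elements are compared with the setoid equality _≈_ of the poset, so that
-- antisymmetry reads x ≤ y → y ≤ x → x ≈ y.

module Bounds {c ℓ₁ ℓ₂} (P : Poset c ℓ₁ ℓ₂) where
  open Poset P

  U : ∀ {ℓ} → Pred Carrier ℓ → Pred Carrier (c ⊔ ℓ₂ ⊔ ℓ)
  U A x = ∀ y → y ∈ A → y ≤ x

  L : ∀ {ℓ} → Pred Carrier ℓ → Pred Carrier (c ⊔ ℓ₂ ⊔ ℓ)
  L A x = ∀ y → y ∈ A → x ≤ y

  singleton : Carrier → Pred Carrier ℓ₁
  singleton a x = x ≈ a

  pair : Carrier → Carrier → Pred Carrier ℓ₁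
  pair a b = singleton a ∪ singleton b

  IsGreatest : ∀ {ℓ} → Pred Carrier ℓ → Pred Carrier (c ⊔ ℓ₂ ⊔ ℓ)
  IsGreatest S m = m ∈ S × (∀ x → x ∈ S → x ≤ m)

  Comparable : Rel Carrier ℓ₂
  Comparable x y = x ≤ y ⊎ y ≤ x

  -- The minimum is a partial operation, defined on comparable elements. By
  -- antisymmetry it does not depend, up to _≈_, on the comparability proof.
  min : ∀ x y → Comparable x y → Carrier
  min x y (inj₁ x≤y) = x
  min x y (inj₂ y≤x) = y

  MinStable : ∀ {ℓ} → Rel Carrier ℓ → Set (c ⊔ ℓ₂ ⊔ ℓ)
  MinStable ρ = ∀ a b c d → ρ a b → ρ c d →
                (a~c : Comparable a c) (b~d : Comparable b d) →
                ρ (min a c a~c) (min b d b~d)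

record SectionallyPseudocomplementedPoset c ℓ₁ ℓ₂ : Set (suc (c ⊔ ℓ₁ ⊔ ℓ₂)) where
  infixl 7 _*_
  field
    poset : Poset c ℓ₁ ℓ₂

  open Poset poset public
  open Bounds poset public

  -- Greatest elements are unique up to _≈_, so the existence of the greatest
  -- c with L(U(a,b),c) = L(b) is given as the operation selecting it.
  field
    _*_        : Op₂ Carrier
    *-greatest : ∀ a b →
                 IsGreatest (λ x → L (U (pair a b) ∪ singleton x) ≐ L (singleton b)) (a * b)

record StronglySectionallyPseudocomplementedPoset c ℓ₁ ℓ₂ : Set (suc (c ⊔ ℓ₁ ⊔ ℓ₂)) where
  field
    sectionallyPseudocomplementedPoset : SectionallyPseudocomplementedPoset c ℓ₁ ℓ₂

  open SectionallyPseudocomplementedPoset sectionallyPseudocomplementedPoset public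

  field
    1#      : Carrier
    maximum : Maximum _≤_ 1#
    strong  : ∀ x y → x ≤ (x * y) * y

module _ {c ℓ₁ ℓ₂} (P : StronglySectionallyPseudocomplementedPoset c ℓ₁ ℓ₂) where
  open StronglySectionallyPseudocomplementedPoset P

  -- A relation on the underlying setoid has to contain _≈_. Compatibility with
  -- the constant 1# is an instance of reflexivity.
  record IsCongruence {ℓ} (Θ : Rel Carrier ℓ) : Set (c ⊔ ℓ₁ ⊔ ℓ₂ ⊔ ℓ) where
    field
      reflexive     : _≈_ ⇒ Θ
      isEquivalence : IsEquivalence Θ
      *-cong        : Congruent₂ Θ _*_
      min-stable    : MinStable Θ

  -- A subset of the underlying setoid has to be closed under _≈_.
  record IsFilter {ℓ} (F : Pred Carrier ℓ) : Set (c ⊔ ℓ₁ ⊔ ℓ₂ ⊔ ℓ) where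
    field
      respects   : F Respects _≈_
      1∈F        : 1# ∈ F
      *-closed   : ∀ x y z → x * y ∈ F → y * x ∈ F →
                   (x * z) * (y * z) ∈ F × (z * x) * (z * y) ∈ F
      min-closed : ∀ x y z v →
                   x * y ∈ F → y * x ∈ F → z * v ∈ F → v * z ∈ F →
                   (x~z : Comparable x z) (y~v : Comparable y v) →
                   min x z x~z * min y v y~v ∈ F

  Con : (ℓ : Level) → Pred (Rel Carrier ℓ) (c ⊔ ℓ₁ ⊔ ℓ₂ ⊔ ℓ)
  Con ℓ Θ = IsCongruence Θ

  Fil : (ℓ : Level) → Pred (Pred Carrier ℓ) (c ⊔ ℓ₁ ⊔ ℓ₂ ⊔ ℓ)
  Fil ℓ F = IsFilter F

  Φ : ∀ {ℓ} → Pred Carrier ℓ → Rel Carrier ℓ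
  Φ M x y = x * y ∈ M × y * x ∈ M

{-# OPTIONS --safe #-}
-- If x * y and y * x are congruent to 1, multiplying by y and x respectively
-- gives (x * y) * y Θ 1 * y ≈ y and x ≈ 1 * x Θ (y * x) * x. By strongness
-- x ≤ (x * y) * y and y ≤ (y * x) * x, so min-stability applied to these two
-- pairs yields x Θ y.
module Submission where

open import Defs
open import Data.Product.Base using (_×_; _,_; proj₁; proj₂)
open import Data.Sum.Base using (inj₁; inj₂; [_,_])
open import Function.Bundles using (_⇔_; mk⇔)
open import Relation.Binary.Core using (Rel) renaming (_⇔_ to _≐ᵣ_)
open import Relation.Binary.Structures using (IsEquivalence)
open import Relation.Unary using (_∈_)

module SectionalPseudocomplement {c ℓ₁ ℓ₂}
  (P : StronglySectionallyPseudocomplementedPoset c ℓ₁ ℓ₂) where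
  open StronglySectionallyPseudocomplementedPoset P

  -- Since `x` itself belongs to `U (pair x x)`, adjoining `1#` leaves exactly the lower bounds of
  -- `x`. Thus `1#` is a candidate for the greatest element that `x * x` names.
  x*x≈1 : ∀ x → x * x ≈ 1#
  x*x≈1 x = antisym (maximum (x * x)) (proj₂ (*-greatest x x) 1#
    ( (λ z∈L y y≈x → trans (z∈L x (inj₁ λ _ → [ reflexive , reflexive ]))
                           (reflexive (Eq.sym y≈x)))
    , λ {z} z∈L y → [ (λ y∈U → trans (z∈L x Eq.refl) (y∈U x (inj₁ Eq.refl)))
                    , (λ y≈1 → trans (maximum z) (reflexive (Eq.sym y≈1))) ]))

  -- Members of `U (pair 1# x)` lie above `1#` and so constrain nothing. The equation defining
  -- `1# * x` then says that `1# * x` and `x` have the same lower bounds.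
  1*x≈x : ∀ x → 1# * x ≈ x
  1*x≈x x = antisym
    (proj₁ L≐ (λ y → [ (λ y∈U → trans (maximum (1# * x)) (y∈U 1# (inj₁ Eq.refl)))
                     , (λ y≈1*x → reflexive (Eq.sym y≈1*x)) ])
              x Eq.refl)
    (proj₂ L≐ (λ y y≈x → reflexive (Eq.sym y≈x)) (1# * x) (inj₂ Eq.refl))
    where L≐ = proj₁ (*-greatest 1# x)

module CongruenceKernel {c ℓ₁ ℓ₂ ℓ}
  (P : StronglySectionallyPseudocomplementedPoset c ℓ₁ ℓ₂)
  {Θ : Rel (StronglySectionallyPseudocomplementedPoset.Carrier P) ℓ} (Θ-cong : IsCongruence P Θ) where

  open StronglySectionallyPseudocomplementedPoset P hiding (isEquivalence; reflexive; refl; trans)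
  open SectionalPseudocomplement P
  open IsCongruence Θ-cong
  open IsEquivalence isEquivalence using (refl; sym; trans)

  -- Multiplying by `y` on the right gives `x * y` congruent to `y * y`, which is `1#`.
  Θ⇒*∈[1] : ∀ {x y} → Θ x y → x * y ∈ [ 1# ] Θ
  Θ⇒*∈[1] {y = y} xΘy = trans (*-cong xΘy refl) (reflexive (x*x≈1 y))

  Θ⇒Φ : ∀ {x y} → Θ x y → Φ P ([ 1# ] Θ) x y
  Θ⇒Φ xΘy = Θ⇒*∈[1] xΘy , Θ⇒*∈[1] (sym xΘy)

  *∈[1]⇒Θ : ∀ {x y} → x * y ∈ [ 1# ] Θ → Θ ((x * y) * y) y
  *∈[1]⇒Θ {y = y} x*yΘ1 = trans (*-cong x*yΘ1 refl) (reflexive (1*x≈x y))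

  Φ⇒Θ : ∀ {x y} → Φ P ([ 1# ] Θ) x y → Θ x y
  Φ⇒Θ {x} {y} (x*yΘ1 , y*xΘ1) =
    min-stable x ((y * x) * x) ((x * y) * y) y
      (sym (*∈[1]⇒Θ y*xΘ1)) (*∈[1]⇒Θ x*yΘ1)
      -- With these comparability proofs the two minima compute to `x` and `y`, so no further
      -- rewriting is needed.
      (inj₁ (strong x y)) (inj₂ (strong y x))

  -- Each closure condition is a compatibility property of `Θ` in disguise: `Φ⇒Θ` turns its premises
  -- into congruences, and `Θ⇒*∈[1]` returns the result to the class of `1#`.
  [1]-isFilter : IsFilter P ([ 1# ] Θ)
  [1]-isFilter = record
    { respects   = λ x≈y xΘ1 → trans (sym (reflexive x≈y)) xΘ1
    ; 1∈F        = refl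
    ; *-closed   = λ x y z p q → let xΘy = Φ⇒Θ (p , q) in
        Θ⇒*∈[1] (*-cong xΘy refl) , Θ⇒*∈[1] (*-cong refl xΘy)
    ; min-closed = λ x y z v p q r s x~z y~v →
        Θ⇒*∈[1] (min-stable x y z v (Φ⇒Θ (p , q)) (Φ⇒Θ (r , s)) x~z y~v)
    }

theorem3p7 : ∀ {c ℓ₁ ℓ₂ ℓ} (P : StronglySectionallyPseudocomplementedPoset c ℓ₁ ℓ₂) →
    let open StronglySectionallyPseudocomplementedPoset P in
    (Θ : Rel Carrier ℓ) → Θ ∈ Con P ℓ →
    ([ 1# ] Θ ∈ Fil P ℓ)
    × (∀ x y → Θ x y ⇔ (x * y ∈ [ 1# ] Θ × y * x ∈ [ 1# ] Θ))
    × (Φ P ([ 1# ] Θ) ≐ᵣ Θ)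
theorem3p7 P Θ Θ-cong =
  [1]-isFilter , (λ x y → mk⇔ Θ⇒Φ Φ⇒Θ) , (Φ⇒Θ , Θ⇒Φ)
  where open CongruenceKernel P Θ-cong
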